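{- Let $\mathcal C$ be a category. If $\mathcal R^{\mathrm{set}}(\mathcal C)$ is univalent, then $\mathcal C$ is univalent.
   Context: We work in univalent foundations. A category has a type of objects, hom-sets, and associative unital composition; it is univalent if for all objects $a,b$ the canonical map $(a=b)\to(a\cong b)$, sending $\mathsf{refl}(a)$ to the identity isomorphism, is an equivalence. $\mathcal R^{\mathrm{set}}(\mathcal C)$ is the category whose objects are pairs $(X,f)$ with $X$ an object of $\mathcal C$ and $f:X\to X$ with $f\circ f=f$; morphisms $(X_1,f_1)\to(X_2,f_2)$ are $g:X_1\to X_2$ with $f_2\circ g\circ f_1=g$; the identity on $(X,f)$ is $f$ and composition is that of $\mathcal C$. -}

{-# OPTIONS --without-K --safe #-}
module Defs where

open import Level using (Level; _⊔_) renaming (suc to lsuc)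
open import Data.Product using (Σ; _,_; proj₁; proj₂; _×_)
open import Relation.Binary.PropositionalEquality
  using (_≡_; refl; sym; trans; cong; subst; module ≡-Reasoning)
open import Relation.Binary.PropositionalEquality.Properties using (trans-symˡ)

module _ {a : Level} where
  isContr : Set a → Set a
  isContr A = Σ A λ c → ∀ x → c ≡ x

  isProp : Set a → Set a
  isProp A = (x y : A) → x ≡ y

  isSet : Set a → Set a
  isSet A = (x y : A) → isProp (x ≡ y)

fiber : ∀ {a b} {A : Set a} {B : Set b} → (A → B) → B → Set (a ⊔ b)
fiber {A = A} f y = Σ A λ x → f x ≡ y

isEquiv : ∀ {a b} {A : Set a} {B : Set b} → (A → B) → Set (a ⊔ b)
isEquiv f = ∀ y → isContr (fiber f y)

isProp→isSet : ∀ {a} {A : Set a} → isProp A → isSet A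
isProp→isSet {A = A} h x y p q = trans (lem p) (sym (lem q))
  where
  lem : ∀ {z} (p : x ≡ z) → p ≡ trans (sym (h x x)) (h x z)
  lem refl = sym (trans-symˡ (h x x))

Σ-≡ : ∀ {a b} {A : Set a} {B : A → Set b} {x x' : A} {y : B x} {y' : B x'}
      (q : x ≡ x') → subst B q y ≡ y' → _≡_ {A = Σ A B} (x , y) (x' , y')
Σ-≡ {x = x} refl e = cong (x ,_) e

Σ-isSet : ∀ {a b} {A : Set a} {B : A → Set b} →
          isSet A → (∀ x → isProp (B x)) → isSet (Σ A B)
Σ-isSet {A = A} {B} sA pB (x , y) (x' , y') p q =
  trans (sym (ret p)) (trans (cong dec (sA x x' (cong proj₁ p) (cong proj₁ q))) (ret q))
  where
  dec : ∀ {u : Σ A B} {v : Σ A B} → proj₁ u ≡ proj₁ v → u ≡ v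
  dec {u} {v} r = Σ-≡ r (pB (proj₁ v) _ _)
  ret : ∀ {u v : Σ A B} (r : u ≡ v) → dec (cong proj₁ r) ≡ r
  ret {u} refl = cong (cong (proj₁ u ,_))
                      (isProp→isSet (pB (proj₁ u)) _ _ (pB (proj₁ u) _ _) refl)

record Category (o h : Level) : Set (lsuc (o ⊔ h)) where
  infixr 9 _∘_
  field
    Ob        : Set o
    Hom       : Ob → Ob → Set h
    id        : ∀ {a} → Hom a a
    _∘_       : ∀ {a b c} → Hom b c → Hom a b → Hom a c
    idˡ       : ∀ {a b} (f : Hom a b) → id ∘ f ≡ f
    idʳ       : ∀ {a b} (f : Hom a b) → f ∘ id ≡ f
    assoc     : ∀ {a b c d} (f : Hom c d) (g : Hom b c) (k : Hom a b) →
                (f ∘ g) ∘ k ≡ f ∘ (g ∘ k)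
    Hom-isSet : ∀ {a b} → isSet (Hom a b)

module _ {o h} (C : Category o h) where
  open Category C

  Iso : Ob → Ob → Set h
  Iso a b = Σ (Hom a b) λ f → Σ (Hom b a) λ g → (g ∘ f ≡ id) × (f ∘ g ≡ id)

  idIso : ∀ a → Iso a a
  idIso a = id , id , idˡ id , idˡ id

  idtoiso : ∀ {a b} → a ≡ b → Iso a b
  idtoiso {a} refl = idIso a

  isUnivalent : Set (o ⊔ h)
  isUnivalent = ∀ a b → isEquiv (idtoiso {a} {b})

module _ {o h} (C : Category o h) where
  open Category C
  open ≡-Reasoning

  RObj : Set (o ⊔ h)
  RObj = Σ Ob λ X → Σ (Hom X X) λ f → f ∘ f ≡ f

  RHom : RObj → RObj → Set h
  RHom (X₁ , f₁ , _) (X₂ , f₂ , _) = Σ (Hom X₁ X₂) λ g → (f₂ ∘ g) ∘ f₁ ≡ g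

  RHom-≡ : ∀ {A B : RObj} {g g' : RHom A B} → proj₁ g ≡ proj₁ g' → g ≡ g'
  RHom-≡ r = Σ-≡ r (Hom-isSet _ _ _ _)

  private
    pre : ∀ {A B : RObj} (g : RHom A B) → proj₁ g ∘ proj₁ (proj₂ A) ≡ proj₁ g
    pre {X₁ , f₁ , e₁} {X₂ , f₂ , e₂} (g , p) = begin
      g ∘ f₁                 ≡⟨ cong (_∘ f₁) (sym p) ⟩
      ((f₂ ∘ g) ∘ f₁) ∘ f₁   ≡⟨ assoc _ _ _ ⟩
      (f₂ ∘ g) ∘ (f₁ ∘ f₁)   ≡⟨ cong ((f₂ ∘ g) ∘_) e₁ ⟩
      (f₂ ∘ g) ∘ f₁          ≡⟨ p ⟩
      g                      ∎

    post : ∀ {A B : RObj} (g : RHom A B) → proj₁ (proj₂ B) ∘ proj₁ g ≡ proj₁ g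
    post {X₁ , f₁ , e₁} {X₂ , f₂ , e₂} (g , p) = begin
      f₂ ∘ g                 ≡⟨ cong (f₂ ∘_) (sym p) ⟩
      f₂ ∘ ((f₂ ∘ g) ∘ f₁)   ≡⟨ sym (assoc _ _ _) ⟩
      (f₂ ∘ (f₂ ∘ g)) ∘ f₁   ≡⟨ cong (_∘ f₁) (sym (assoc _ _ _)) ⟩
      ((f₂ ∘ f₂) ∘ g) ∘ f₁   ≡⟨ cong (λ z → (z ∘ g) ∘ f₁) e₂ ⟩
      (f₂ ∘ g) ∘ f₁          ≡⟨ p ⟩
      g                      ∎

  Rid : ∀ {A : RObj} → RHom A A
  Rid {X , f , e} = f , trans (cong (_∘ f) e) e

  Rcomp : ∀ {A B D : RObj} → RHom B D → RHom A B → RHom A D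
  Rcomp {A@(X₁ , f₁ , e₁)} {B} {D@(X₃ , f₃ , e₃)} G@(g , pg) H@(k , pk) =
    g ∘ k , (begin
      (f₃ ∘ (g ∘ k)) ∘ f₁   ≡⟨ cong (_∘ f₁) (sym (assoc _ _ _)) ⟩
      ((f₃ ∘ g) ∘ k) ∘ f₁   ≡⟨ cong (λ z → (z ∘ k) ∘ f₁) (post {B} {D} G) ⟩
      (g ∘ k) ∘ f₁          ≡⟨ assoc _ _ _ ⟩
      g ∘ (k ∘ f₁)          ≡⟨ cong (g ∘_) (pre {A} {B} H) ⟩
      g ∘ k                 ∎)

  Rset : Category (o ⊔ h) h
  Rset = record
    { Ob        = RObj
    ; Hom       = RHom
    ; id        = λ {A} → Rid {A}
    ; _∘_       = λ {A} {B} {D} → Rcomp {A} {B} {D}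
    ; idˡ       = λ {A} {B} g → RHom-≡ {A} {B} (post {A} {B} g)
    ; idʳ       = λ {A} {B} g → RHom-≡ {A} {B} (pre {A} {B} g)
    ; assoc     = λ {A} {B} {D} {E} f g k → RHom-≡ {A} {E} (assoc _ _ _)
    ; Hom-isSet = λ {A} {B} → Σ-isSet Hom-isSet (λ g → Hom-isSet _ _)
    }

{-# OPTIONS --safe #-}
{-# OPTIONS --without-K #-}
module Submission where

-- The inclusion ι a = (a , id) of C into R^set(C) induces maps on identity
-- types and on isomorphisms that both have retractions (cong proj₁, and
-- forgetting that the components are morphisms of R^set(C)), compatibly
-- with idtoiso. So idtoiso for C is a retract of idtoiso for R^set(C), and
-- equivalences are closed under retracts.

open import Level using (Level)
open import Data.Product using (Σ; _,_; proj₁; proj₂; _×_)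
open import Relation.Binary.PropositionalEquality
  using (_≡_; refl; sym; trans; cong; cong₂; module ≡-Reasoning)
open import Relation.Binary.PropositionalEquality.Properties using (cong-id; cong-∘)
open import Defs

retract-isContr : ∀ {a b} {A : Set a} {B : Set b} (s : A → B) (r : B → A) →
                  (∀ x → r (s x) ≡ x) → isContr B → isContr A
retract-isContr s r rs (c , contr) = r c , λ x → trans (cong r (contr (s x))) (rs x)

isEquiv-retract : ∀ {a b a' b'} {A : Set a} {B : Set b} {A' : Set a'} {B' : Set b'} →
  isSet B → (f : A → B) (g : A' → B') →
  (s : A → A') (r : A' → A) (t : B → B') (u : B' → B) →
  (∀ x → r (s x) ≡ x) → (∀ y → u (t y) ≡ y) →
  (∀ x → g (s x) ≡ t (f x)) → (∀ x' → f (r x') ≡ u (g x')) →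
  isEquiv g → isEquiv f
isEquiv-retract B-isSet f g s r t u rs ut gs fr g-isEquiv y =
  retract-isContr sFib rFib rsFib (g-isEquiv (t y))
  where
  sFib : fiber f y → fiber g (t y)
  sFib (x , p) = s x , trans (gs x) (cong t p)

  rFib : fiber g (t y) → fiber f y
  rFib (x' , p') = r x' , trans (fr x') (trans (cong u p') (ut y))

  rsFib : ∀ φ → rFib (sFib φ) ≡ φ
  rsFib (x , p) = Σ-≡ (rs x) (B-isSet _ _ _ _)

module _ {o h : Level} (C : Category o h) where
  open Category C

  inverse-unique : ∀ {a b} {f : Hom a b} {g g' : Hom b a} →
                   g ∘ f ≡ id → f ∘ g' ≡ id → g ≡ g'
  inverse-unique {f = f} {g} {g'} gf fg' = begin
    g              ≡⟨ sym (idʳ g) ⟩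
    g ∘ id         ≡⟨ cong (g ∘_) (sym fg') ⟩
    g ∘ (f ∘ g')   ≡⟨ sym (assoc g f g') ⟩
    (g ∘ f) ∘ g'   ≡⟨ cong (_∘ g') gf ⟩
    id ∘ g'        ≡⟨ idˡ g' ⟩
    g'             ∎
    where open ≡-Reasoning

  isIso-isProp : ∀ {a b} (f : Hom a b) →
                 isProp (Σ (Hom b a) λ g → (g ∘ f ≡ id) × (f ∘ g ≡ id))
  isIso-isProp f (g , gf , fg) (g' , gf' , fg') =
    Σ-≡ (inverse-unique gf fg') (cong₂ _,_ (Hom-isSet _ _ _ _) (Hom-isSet _ _ _ _))

  Iso-≡ : ∀ {a b} {i j : Iso C a b} → proj₁ i ≡ proj₁ j → i ≡ j
  Iso-≡ {j = j} p = Σ-≡ p (isIso-isProp (proj₁ j) _ _)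

  Iso-isSet : ∀ {a b} → isSet (Iso C a b)
  Iso-isSet = Σ-isSet Hom-isSet isIso-isProp

module _ {o h : Level} (C : Category o h) where
  open Category C

  ι : Ob → RObj C
  ι a = a , id , idˡ id

  cong-proj₁-ι : ∀ {a b} (q : a ≡ b) → cong proj₁ (cong ι q) ≡ q
  cong-proj₁-ι q = trans (sym (cong-∘ q)) (cong-id q)

  ι-Hom : ∀ {a b} → Hom a b → RHom C (ι a) (ι b)
  ι-Hom f = f , trans (cong (_∘ id) (idˡ f)) (idʳ f)

  ι-Iso : ∀ {a b} → Iso C a b → Iso (Rset C) (ι a) (ι b)
  ι-Iso (f , g , gf , fg) =
    ι-Hom f , ι-Hom g , RHom-≡ C {ι _} {ι _} gf , RHom-≡ C {ι _} {ι _} fg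

  underlyingIso : ∀ {a b} → Iso (Rset C) (ι a) (ι b) → Iso C a b
  underlyingIso ((f , _) , (g , _) , gf , fg) = f , g , cong proj₁ gf , cong proj₁ fg

  underlyingIso-ι-Iso : ∀ {a b} (i : Iso C a b) → underlyingIso (ι-Iso i) ≡ i
  underlyingIso-ι-Iso i = Iso-≡ C refl

  idtoiso-cong-ι : ∀ {a b} (q : a ≡ b) →
                   idtoiso (Rset C) (cong ι q) ≡ ι-Iso (idtoiso C q)
  idtoiso-cong-ι {a} refl = Iso-≡ (Rset C) {ι a} {ι a} (RHom-≡ C {ι a} {ι a} refl)

  -- The idempotent of the source appears because it is the identity of R^set(C).
  idtoiso-Rset-underlying : ∀ {A B : RObj C} (P : A ≡ B) →
    proj₁ (proj₁ (idtoiso (Rset C) P)) ≡ proj₁ (idtoiso C (cong proj₁ P)) ∘ proj₁ (proj₂ A)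
  idtoiso-Rset-underlying {X , e , _} refl = sym (idˡ e)

  idtoiso-cong-proj₁ : ∀ {a b} (P : ι a ≡ ι b) →
    idtoiso C (cong proj₁ P) ≡ underlyingIso (idtoiso (Rset C) P)
  idtoiso-cong-proj₁ P =
    Iso-≡ C (sym (trans (idtoiso-Rset-underlying P) (idʳ _)))

proposition41 : ∀ {o h : Level} (C : Category o h) →
    isUnivalent (Rset C) → isUnivalent C
proposition41 C Rset-univalent a b =
  isEquiv-retract (Iso-isSet C) (idtoiso C) (idtoiso (Rset C))
    (cong (ι C)) (cong proj₁) (ι-Iso C) (underlyingIso C)
    (cong-proj₁-ι C) (underlyingIso-ι-Iso C)
    (idtoiso-cong-ι C) (idtoiso-cong-proj₁ C)
    (Rset-univalent (ι C a) (ι C b))
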